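{- Let $\Lambda$ be a set of positive integers such that for all positive integers $a,b$: $a,b\in\Lambda$ if and only if $\operatorname{lcm}(a,b)\in\Lambda$. Suppose $\sigma=(\varepsilon,\varepsilon,\gamma;(123))$ is an autoparatopism of a Latin square $L$ of order $n$, and let $R_\Lambda=\{i\in[n]:o_\gamma(i)\in\Lambda\}$. If $R_\Lambda\ne\emptyset$, then the submatrix of $L$ with rows $R_\Lambda$ and columns $R_\Lambda$ is a subsquare of $L$ whose symbol set is $R_\Lambda$.
   Context: A Latin square $L$ of order $n$ is an $n\times n$ array with rows, columns and symbols indexed by $[n]$, in which each symbol occurs exactly once in each row and each column. Its set of triples is $O(L)$. A subsquare is a submatrix that is itself a Latin square. Permutations act on the right; $\varepsilon$ is the identity. A paratopism $(\alpha,\beta,\gamma;(123))$ maps $L$ to $L^\sigma$ with triple set $\{(z\gamma,x\alpha,y\beta):(x,y,z)\in O(L)\}$. It is an autoparatopism of $L$ if $L^\sigma=L$. $o_\pi(i)$ is the length of the cycle of $\pi$ containing $i$ (fixed points are cycles of length $1$). -}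

module Defs where

open import Level using (Level; _⊔_)
open import Data.Nat.Base using (ℕ; zero; suc; _+_; _∸_; _<_; z<s; s<s⁻¹)
open import Data.Nat.GeneralisedArithmetic using (fold; fold-+)
open import Data.Nat.Properties using (m+[n∸m]≡n; <⇒≤; m<n⇒0<n∸m; n<1+n)
open import Data.Fin.Base using (Fin; toℕ)
open import Data.Fin.Properties using (_≟_; pigeonhole)
open import Data.Fin.Permutation using (Permutation′; _⟨$⟩ʳ_; _⟨$⟩ˡ_; inverseˡ)
open import Data.Product using (_×_; _,_; ∃; ∃₂; ∃!; proj₁; proj₂)
open import Relation.Binary.PropositionalEquality using (_≡_; _≢_; refl; sym; trans; cong)
open import Relation.Nullary.Decidable using (yes; no)
open import Relation.Nullary.Negation using (¬_; contradiction)
open import Relation.Unary using (Pred; Decidable; Satisfiable; U; _∈_; _≐_)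

private
  variable
    r c s ℓ : Level
    n : ℕ

-- The index set [n] is represented by Fin n.
Array : ℕ → Set
Array n = Fin n → Fin n → Fin n

-- The submatrix of M with rows R and columns C is a Latin square on the
-- symbol set S.  Each row gives a bijection between C and S and each column
-- one between R and S, so R, C and S automatically have the same size as soon
-- as R and C are nonempty.
record IsLatin {n : ℕ} (M : Array n) (R : Pred (Fin n) r) (C : Pred (Fin n) c)
               (S : Pred (Fin n) s) : Set (r ⊔ c ⊔ s) where
  field
    entry  : ∀ {i j} → i ∈ R → j ∈ C → M i j ∈ S
    row    : ∀ {i k} → i ∈ R → k ∈ S → ∃! _≡_ (λ j → j ∈ C × M i j ≡ k)
    column : ∀ {j k} → j ∈ C → k ∈ S → ∃! _≡_ (λ i → i ∈ R × M i j ≡ k)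

record LatinSquare (n : ℕ) : Set where
  field
    array   : Array n
    isLatin : IsLatin array U U U

open LatinSquare public

SymbolSet : LatinSquare n → Pred (Fin n) r → Pred (Fin n) c → Pred (Fin n) (r ⊔ c)
SymbolSet L R C k = ∃₂ λ i j → i ∈ R × j ∈ C × array L i j ≡ k

record IsSubsquare {n : ℕ} (L : LatinSquare n) (R : Pred (Fin n) r) (C : Pred (Fin n) c)
                   : Set (r ⊔ c) where
  field
    rows-nonempty    : Satisfiable R
    columns-nonempty : Satisfiable C
    latin            : IsLatin (array L) R C (SymbolSet L R C)

Triple : ℕ → Set
Triple n = Fin n × Fin n × Fin n

O : LatinSquare n → Pred (Triple n) _
O L (x , y , z) = array L x y ≡ z

-- The triple set of L^σ for σ = (α, β, γ; (123)); the right action xα is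
-- written α ⟨$⟩ʳ x.
O^⟨_,_,_⟩₁₂₃ : (α β γ : Permutation′ n) → LatinSquare n → Pred (Triple n) _
O^⟨ α , β , γ ⟩₁₂₃ L t =
  ∃ λ x → ∃ λ y → ∃ λ z → (x , y , z) ∈ O L × t ≡ (γ ⟨$⟩ʳ z , α ⟨$⟩ʳ x , β ⟨$⟩ʳ y)

-- L^σ = L, expressed through triple sets (which determine a Latin square).
IsAutoparatopism₁₂₃ : (α β γ : Permutation′ n) → LatinSquare n → Set
IsAutoparatopism₁₂₃ α β γ L = O^⟨ α , β , γ ⟩₁₂₃ L ≐ O L

-- i ⟪ π ^ k ⟫ is iπᵏ.
_⟪_^_⟫ : Fin n → Permutation′ n → ℕ → Fin n
i ⟪ π ^ k ⟫ = fold i (π ⟨$⟩ʳ_) k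

record IsCycleLength {n : ℕ} (π : Permutation′ n) (i : Fin n) (k : ℕ) : Set where
  field
    positive : 0 < k
    returns  : i ⟪ π ^ k ⟫ ≡ i
    minimal  : ∀ {m} → 0 < m → m < k → i ⟪ π ^ m ⟫ ≢ i

private
  ⟨$⟩ʳ-injective : (π : Permutation′ n) {x y : Fin n} → π ⟨$⟩ʳ x ≡ π ⟨$⟩ʳ y → x ≡ y
  ⟨$⟩ʳ-injective π eq = trans (sym (inverseˡ π)) (trans (cong (π ⟨$⟩ˡ_) eq) (inverseˡ π))

  ^-injective : (π : Permutation′ n) (k : ℕ) {x y : Fin n} →
                x ⟪ π ^ k ⟫ ≡ y ⟪ π ^ k ⟫ → x ≡ y
  ^-injective π zero    eq = eq
  ^-injective π (suc k) eq = ^-injective π k (⟨$⟩ʳ-injective π eq)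

  some-return : (π : Permutation′ n) (i : Fin n) → ∃ λ k → i ⟪ π ^ suc k ⟫ ≡ i
  some-return {n} π i
    with a , b , a<b , eq ← pigeonhole (n<1+n n) (λ p → i ⟪ π ^ toℕ p ⟫)
    with toℕ b ∸ toℕ a in d | m<n⇒0<n∸m a<b
  ... | suc k | _ = k , sym (^-injective π (toℕ a) (trans eq (trans
          (cong (i ⟪ π ^_⟫) (trans (sym (m+[n∸m]≡n (<⇒≤ a<b))) (cong (toℕ a +_) d)))
          (fold-+ i (π ⟨$⟩ʳ_) (toℕ a)))))

  least : {P : Pred ℕ ℓ} → Decidable P → ∀ k → P k →
          ∃ λ m → P m × (∀ {j} → j < m → ¬ P j)
  least P? k pk with P? zero
  ... | yes p0 = zero , p0 , λ ()
  least P? zero    pk | no ¬p0 = contradiction pk ¬p0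
  least P? (suc k) pk | no ¬p0 with m , pm , min ← least (λ j → P? (suc j)) k pk =
    suc m , pm , λ { {zero} _ → ¬p0 ; {suc j} j<m → min (s<s⁻¹ j<m) }

cycleLength : (π : Permutation′ n) (i : Fin n) → ∃ (IsCycleLength π i)
cycleLength π i
  with k , ret ← some-return π i
  with m , eq , min ← least (λ j → i ⟪ π ^ suc j ⟫ ≟ i) k ret =
  suc m , record
    { positive = z<s
    ; returns  = eq
    ; minimal  = λ { {suc j} _ j<m → min (s<s⁻¹ j<m) }
    }

o : Permutation′ n → Fin n → ℕ
o π i = proj₁ (cycleLength π i)

o-isCycleLength : (π : Permutation′ n) (i : Fin n) → IsCycleLength π i (o π i)
o-isCycleLength π i = proj₂ (cycleLength π i)

R[_,_] : Pred ℕ ℓ → Permutation′ n → Pred (Fin n) ℓ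
R[ Λ , γ ] i = o γ i ∈ Λ

{-# OPTIONS --safe #-}
-- Applying (x,y,z) ↦ (zγ,x,y) three times gives (x,y,z) ↦ (xγ,yγ,zγ), so γ and
-- all its powers are automorphisms of L.  If a power γᵐ fixes two coordinates
-- of a triple of L, it therefore fixes the third.  With m the lcm of the cycle
-- lengths of two coordinates, the cycle length of the third divides m, and Λ is
-- closed under lcm and under divisors.
module Submission where

open import Defs
open import Level using (Level)
open import Data.Nat.Base using (ℕ; zero; suc; _+_; _*_; _<_; z<s; NonZero; >-nonZero)
open import Data.Nat.DivMod using (_/_; _%_; m≡m%n+[m/n]*n; m%n<n)
open import Data.Nat.Divisibility using (_∣_; divides; ∣-refl; ∣-antisym)
open import Data.Nat.GeneralisedArithmetic using (fold-+)
open import Data.Nat.LCM using (lcm; lcm-least; m∣lcm[m,n]; n∣lcm[m,n])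
open import Data.Fin.Base using (Fin)
open import Data.Fin.Permutation using (Permutation′; _⟨$⟩ʳ_) renaming (id to ε)
open import Data.Product using (_×_; _,_; ∃!; proj₁; proj₂)
open import Function.Bundles using (_⇔_; Equivalence)
open import Relation.Binary.PropositionalEquality using (_≡_; refl; sym; trans; cong; cong₂; subst; module ≡-Reasoning)
open import Relation.Nullary.Negation using (contradiction)
open import Relation.Unary using (Pred; Satisfiable; _∈_; _⊆_; _≐_)

private
  variable
    ℓ : Level
    n : ℕ

Fixes : Permutation′ n → Fin n → ℕ → Set
Fixes π i m = i ⟪ π ^ m ⟫ ≡ i

Fixes-* : (π : Permutation′ n) {i : Fin n} {k : ℕ} (q : ℕ) → Fixes π i k → Fixes π i (q * k)
Fixes-* π         zero    fix = refl
Fixes-* π {i} {k} (suc q) fix =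
  trans (fold-+ i (π ⟨$⟩ʳ_) k) (trans (cong (_⟪ π ^ k ⟫) (Fixes-* π q fix)) fix)

module _ {π : Permutation′ n} {i : Fin n} {k : ℕ} (cyc : IsCycleLength π i k) where
  open IsCycleLength cyc

  ∣⇒Fixes : ∀ {m} → k ∣ m → Fixes π i m
  ∣⇒Fixes (divides q refl) = Fixes-* π q returns

  -- Divide `m` by `k`: a nonzero remainder would itself be a positive return time below `k`,
  -- against minimality.
  Fixes⇒∣ : ∀ {m} → Fixes π i m → k ∣ m
  Fixes⇒∣ {m} fix = quotient (m % k) (m%n<n m k) (m≡m%n+[m/n]*n m k)
    where
    instance
      k≢0 : NonZero k
      k≢0 = >-nonZero positive

    -- The remainder is generalised to a variable `r` so that it can be split into zero and
    -- successor.
    quotient : ∀ r → r < k → m ≡ r + m / k * k → k ∣ m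
    quotient zero    r<k m≡ = divides (m / k) m≡
    quotient (suc r) r<k m≡ = contradiction fix-r (minimal z<s r<k)
      where
      open ≡-Reasoning
      fix-r : Fixes π i (suc r)
      fix-r = begin
        i ⟪ π ^ suc r ⟫                     ≡⟨ cong (_⟪ π ^ suc r ⟫) (Fixes-* π (m / k) returns) ⟨
        (i ⟪ π ^ m / k * k ⟫) ⟪ π ^ suc r ⟫ ≡⟨ fold-+ i (π ⟨$⟩ʳ_) (suc r) ⟨
        i ⟪ π ^ suc r + m / k * k ⟫         ≡⟨ cong (i ⟪ π ^_⟫) m≡ ⟨
        i ⟪ π ^ m ⟫                         ≡⟨ fix ⟩
        i                                   ∎

o-positive : (π : Permutation′ n) (i : Fin n) → 0 < o π i
o-positive π i = IsCycleLength.positive (o-isCycleLength π i)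

∃!-unique : ∀ {A : Set} {P : Pred A ℓ} → ∃! _≡_ P → ∀ {x y} → P x → P y → x ≡ y
∃!-unique (_ , _ , unique) px py = trans (sym (unique px)) (unique py)

module _ (L : LatinSquare n) where
  open IsLatin (isLatin L)

  row-cancel : ∀ {x y y′} → array L x y ≡ array L x y′ → y ≡ y′
  row-cancel {x} eq = ∃!-unique (row {x} _ _) (_ , eq) (_ , refl)

  column-cancel : ∀ {x x′ y} → array L x y ≡ array L x′ y → x ≡ x′
  column-cancel {y = y} eq = ∃!-unique (column {y} _ _) (_ , eq) (_ , refl)

module _ (L : LatinSquare n) (γ : Permutation′ n) (auto : IsAutoparatopism₁₂₃ ε ε γ L) where

  rotate : ∀ {x y z} → (x , y , z) ∈ O L → (γ ⟨$⟩ʳ z , x , y) ∈ O L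
  rotate t = proj₁ auto (_ , _ , _ , t , refl)

  ^-automorphism : ∀ m {x y z} → (x , y , z) ∈ O L →
                   (x ⟪ γ ^ m ⟫ , y ⟪ γ ^ m ⟫ , z ⟪ γ ^ m ⟫) ∈ O L
  ^-automorphism zero    t = t
  -- The triple `(x , y , z)` passes through (zγ, x, y) and (yγ, zγ, x) to (xγ, yγ, zγ).
  ^-automorphism (suc m) t = rotate (rotate (rotate (^-automorphism m t)))

  module _ {x y z : Fin n} (t : (x , y , z) ∈ O L) (m : ℕ) where
    open ≡-Reasoning

    Fixes-symbol : Fixes γ x m → Fixes γ y m → Fixes γ z m
    Fixes-symbol fx fy = begin
      z ⟪ γ ^ m ⟫                           ≡⟨ ^-automorphism m t ⟨
      array L (x ⟪ γ ^ m ⟫) (y ⟪ γ ^ m ⟫)   ≡⟨ cong₂ (array L) fx fy ⟩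
      array L x y                           ≡⟨ t ⟩
      z                                     ∎

    -- Row `x` carries the symbol `z` both in column `y` and in column `y ⟪ γ ^ m ⟫`, so these
    -- columns coincide.
    Fixes-column : Fixes γ x m → Fixes γ z m → Fixes γ y m
    Fixes-column fx fz = row-cancel L (begin
      array L x (y ⟪ γ ^ m ⟫)               ≡⟨ cong (λ w → array L w (y ⟪ γ ^ m ⟫)) fx ⟨
      array L (x ⟪ γ ^ m ⟫) (y ⟪ γ ^ m ⟫)   ≡⟨ ^-automorphism m t ⟩
      z ⟪ γ ^ m ⟫                           ≡⟨ fz ⟩
      z                                     ≡⟨ t ⟨
      array L x y                           ∎)

    Fixes-row : Fixes γ y m → Fixes γ z m → Fixes γ x m
    Fixes-row fy fz = column-cancel L (begin
      array L (x ⟪ γ ^ m ⟫) y               ≡⟨ cong (array L (x ⟪ γ ^ m ⟫)) fy ⟨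
      array L (x ⟪ γ ^ m ⟫) (y ⟪ γ ^ m ⟫)   ≡⟨ ^-automorphism m t ⟩
      z ⟪ γ ^ m ⟫                           ≡⟨ fz ⟩
      z                                     ≡⟨ t ⟨
      array L x y                           ∎)

-- This turns closure under lcm into closure under divisors: `l ∈ Λ` can be read as `lcm c l ∈ Λ`,
-- which the converse half of `Λ-lcm` splits.
∣⇒lcm≡ : ∀ {c l} → c ∣ l → lcm c l ≡ l
∣⇒lcm≡ {c} {l} c∣l = ∣-antisym (lcm-least c∣l ∣-refl) (n∣lcm[m,n] c l)

module _ {Λ : Pred ℕ ℓ} (Λ-positive : ∀ a → a ∈ Λ → 0 < a)
         (Λ-lcm : ∀ a b → 0 < a → 0 < b → (a ∈ Λ × b ∈ Λ) ⇔ (lcm a b ∈ Λ)) where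

  ∣lcm⇒∈ : ∀ {a b c} → a ∈ Λ → b ∈ Λ → 0 < c → c ∣ lcm a b → c ∈ Λ
  ∣lcm⇒∈ {a} {b} {c} a∈ b∈ 0<c c∣ =
    -- Positivity of `lcm a b` is read off from its membership in `Λ`.
    proj₁ (from (Λ-lcm c (lcm a b) 0<c (Λ-positive _ l∈)) (subst (_∈ Λ) (sym (∣⇒lcm≡ c∣)) l∈))
    where
    open Equivalence
    l∈ : lcm a b ∈ Λ
    l∈ = to (Λ-lcm a b (Λ-positive a a∈) (Λ-positive b b∈)) (a∈ , b∈)

  -- The assumption on `u`, `v`, `w` is symmetric in the roles of row, column and symbol, so one
  -- argument serves all three fields of `R-latin`. The exponent chosen is the lcm of the two known
  -- cycle lengths, which both divide.
  R-closed : (γ : Permutation′ n) {u v w : Fin n} → u ∈ R[ Λ , γ ] → v ∈ R[ Λ , γ ] →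
             (∀ m → Fixes γ u m → Fixes γ v m → Fixes γ w m) → w ∈ R[ Λ , γ ]
  R-closed γ {u} {v} {w} u∈ v∈ fixes =
    ∣lcm⇒∈ u∈ v∈ (o-positive γ w) (Fixes⇒∣ (o-isCycleLength γ w) (fixes (lcm (o γ u) (o γ v))
      (∣⇒Fixes (o-isCycleLength γ u) (m∣lcm[m,n] (o γ u) (o γ v)))
      (∣⇒Fixes (o-isCycleLength γ v) (n∣lcm[m,n] (o γ u) (o γ v)))))

  module _ (L : LatinSquare n) (γ : Permutation′ n) (auto : IsAutoparatopism₁₂₃ ε ε γ L) where
    open IsLatin (isLatin L) using (row; column)

    R-latin : IsLatin (array L) R[ Λ , γ ] R[ Λ , γ ] R[ Λ , γ ]
    R-latin = record
      { entry  = λ i∈ j∈ → R-closed γ i∈ j∈ (Fixes-symbol L γ auto refl)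
      -- The witness is the column that `L` itself provides; only its membership in `R[ Λ , γ ]` is
      -- new, and uniqueness is inherited from `L`.
      ; row    = λ {i} {k} i∈ k∈ → let j , (_ , t) , unique = row {i} {k} _ _ in
          j , (R-closed γ i∈ k∈ (Fixes-column L γ auto t) , t) , λ (_ , t′) → unique (_ , t′)
      ; column = λ {j} {k} j∈ k∈ → let i , (_ , t) , unique = column {j} {k} _ _ in
          i , (R-closed γ j∈ k∈ (Fixes-row L γ auto t) , t) , λ (_ , t′) → unique (_ , t′)
      }

module _ (L : LatinSquare n) {R S : Pred (Fin n) ℓ} (latin : IsLatin (array L) R R S) where
  open IsLatin latin

  SymbolSet⊆ : SymbolSet L R R ⊆ S
  SymbolSet⊆ (_ , _ , i∈ , j∈ , refl) = entry i∈ j∈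

  -- Nonemptiness supplies a row, and every symbol of `S` occurs in that row.
  ⊆SymbolSet : Satisfiable R → S ⊆ SymbolSet L R R
  ⊆SymbolSet (i , i∈) k∈ = let j , (j∈ , t) , _ = row i∈ k∈ in i , j , i∈ , j∈ , t

  IsLatin⇒IsSubsquare : Satisfiable R → IsSubsquare L R R
  IsLatin⇒IsSubsquare nonempty = record
    { rows-nonempty    = nonempty
    ; columns-nonempty = nonempty
    ; latin            = record
      { entry  = λ i∈ j∈ → _ , _ , i∈ , j∈ , refl
      -- Symbols that actually occur lie in `S`, so the unique positions given by `latin` carry
      -- over.
      ; row    = λ i∈ k∈ → row i∈ (SymbolSet⊆ k∈)
      ; column = λ j∈ k∈ → column j∈ (SymbolSet⊆ k∈)
      }
    }

theorem3p6 : ∀ {ℓ : Level} (Λ : Pred ℕ ℓ) →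
    (∀ a → a ∈ Λ → 0 < a) →
    (∀ a b → 0 < a → 0 < b → (a ∈ Λ × b ∈ Λ) ⇔ (lcm a b ∈ Λ)) →
    ∀ (n : ℕ) (L : LatinSquare n) (γ : Permutation′ n) →
    IsAutoparatopism₁₂₃ ε ε γ L →
    Satisfiable R[ Λ , γ ] →
    IsSubsquare L R[ Λ , γ ] R[ Λ , γ ] × (SymbolSet L R[ Λ , γ ] R[ Λ , γ ] ≐ R[ Λ , γ ])
theorem3p6 Λ Λ-positive Λ-lcm n L γ auto nonempty =
  IsLatin⇒IsSubsquare L latin nonempty , SymbolSet⊆ L latin , ⊆SymbolSet L latin nonempty
  where
  latin : IsLatin (array L) R[ Λ , γ ] R[ Λ , γ ] R[ Λ , γ ]
  latin = R-latin Λ-positive Λ-lcm L γ auto
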